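{- Let $\lambda$ be a nonzero real number. Let $\{T_{n}^{(3)}\}_{n\ge 0}$ be defined by $T_{0}^{(3)}=T_{1}^{(3)}=0$, $T_{2}^{(3)}=1$ and $T_{n+3}^{(3)}=T_{n+2}^{(3)}+3T_{n+1}^{(3)}+9T_{n}^{(3)}$ for $n\ge 0$. Then for all $n\ge 2$, $$T_{n-1}^{(3)}=\frac{1}{9\lambda^{n}}H_{n}^{(3)}(1,0,0;\lambda,3\lambda^{2},9\lambda^{3}),$$ where $H_n^{(3)}(a,b,c;r,s,t)$ denotes the $n$-th third-order Horadam number.
   Context: For given numbers $a,b,c,r,s,t$, the third-order Horadam numbers $H_{n}^{(3)}=H_{n}^{(3)}(a,b,c;r,s,t)$, $n\ge 0$, are defined by $H_{0}^{(3)}=a$, $H_{1}^{(3)}=b$, $H_{2}^{(3)}=c$ and $H_{n+3}^{(3)}=rH_{n+2}^{(3)}+sH_{n+1}^{(3)}+tH_{n}^{(3)}$ for $n\ge 0$. The superscript $(3)$ is part of the notation, not an exponent. -}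

module Defs where

open import Level using (_⊔_) renaming (suc to lsuc)
open import Data.Nat.Base using (ℕ; zero; suc) renaming (_≤_ to _≤ℕ_)
open import Data.Product.Base using (Σ-syntax; ∃-syntax; _×_; proj₁)
open import Data.Sum.Base using (_⊎_; inj₂)
open import Function.Bundles using (_⇔_; module Equivalence)
open import Relation.Binary.Core using (Rel)
open import Relation.Binary.Structures using (IsStrictPartialOrder)
open import Algebra.Bundles using (CommutativeRing; Semiring)
open import Algebra.Apartness.Bundles using (HeytingField; HeytingCommutativeRing)
import Algebra.Apartness.Properties.HeytingCommutativeRing as HCRProperties
import Algebra.Definitions.RawSemiring as RawSemiringDefinitions

-- The real numbers, given axiomatically as a Cauchy-complete Archimedean
-- ordered field. Classically such a structure is unique up to isomorphism.
-- "Nonzero" is the apartness x # 0#, i.e. x < 0# or 0# < x; it is the notion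
-- that provides a multiplicative inverse constructively, and with excluded
-- middle it is the same as ¬ (x ≈ 0#).
record RealNumbers c ℓ₁ ℓ₂ : Set (lsuc (c ⊔ ℓ₁ ⊔ ℓ₂)) where
  field
    heytingField : HeytingField c ℓ₁ ℓ₂

  open HeytingField heytingField public

  commutativeRing : CommutativeRing c ℓ₁
  commutativeRing = HeytingCommutativeRing.commutativeRing heytingCommutativeRing

  open RawSemiringDefinitions (Semiring.rawSemiring (CommutativeRing.semiring commutativeRing)) public
    using (_^_) renaming (_×_ to _·_)

  nat : ℕ → Carrier
  nat n = n · 1#

  infix 4 _<_
  field
    _<_                    : Rel Carrier ℓ₂
    <-isStrictPartialOrder : IsStrictPartialOrder _≈_ _<_
    #⇔<⊎>                  : ∀ {x y} → x # y ⇔ (x < y ⊎ y < x)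
    0<1                    : 0# < 1#
    +-monoˡ-<              : ∀ {x y} z → x < y → x + z < y + z
    *-pos                  : ∀ {x y} → 0# < x → 0# < y → 0# < x * y
    archimedean            : ∀ x → ∃[ n ] x < nat n

  -- ∣ x - y ∣ < ε
  Close : Carrier → Carrier → Carrier → Set ℓ₂
  Close ε x y = (x < y + ε) × (y < x + ε)

  Cauchy : (ℕ → Carrier) → Set (c ⊔ ℓ₂)
  Cauchy u = ∀ ε → 0# < ε →
    Σ[ N ∈ ℕ ] (∀ m n → N ≤ℕ m → N ≤ℕ n → Close ε (u m) (u n))

  _ConvergesTo_ : (ℕ → Carrier) → Carrier → Set (c ⊔ ℓ₂)
  u ConvergesTo l = ∀ ε → 0# < ε →
    Σ[ N ∈ ℕ ] (∀ n → N ≤ℕ n → Close ε (u n) l)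

  field
    complete : ∀ u → Cauchy u → ∃[ l ] u ConvergesTo l

module Horadam {c ℓ₁ ℓ₂} (ℝ : RealNumbers c ℓ₁ ℓ₂) where

  open RealNumbers ℝ
  open HCRProperties heytingCommutativeRing using (1#0; x#0y#0→xy#0)
  open IsStrictPartialOrder <-isStrictPartialOrder
    using (<-respʳ-≈; <-respˡ-≈) renaming (trans to <-trans)

  -- The library's inverse is that of x - 0#.
  1/_⟨_⟩ : (x : Carrier) → x # 0# → Carrier
  1/ x ⟨ x#0 ⟩ = proj₁ (#⇒invertible x#0)

  0<nat[1+n] : ∀ n → 0# < nat (suc n)
  0<nat[1+n] zero    = <-respʳ-≈ (sym (+-identityʳ 1#)) 0<1
  0<nat[1+n] (suc n) = <-trans (0<nat[1+n] n)
    (<-respˡ-≈ (+-identityˡ (nat (suc n))) (+-monoˡ-< (nat (suc n)) 0<1))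

  nat[1+n]#0 : ∀ n → nat (suc n) # 0#
  nat[1+n]#0 n = Equivalence.from #⇔<⊎> (inj₂ (0<nat[1+n] n))

  ^-#0 : ∀ {x} → x # 0# → ∀ n → x ^ n # 0#
  ^-#0 x#0 zero    = 1#0
  ^-#0 x#0 (suc n) = x#0y#0→xy#0 x#0 (^-#0 x#0 n)

  9xⁿ#0 : ∀ {x} → x # 0# → ∀ n → nat 9 * x ^ n # 0#
  9xⁿ#0 x#0 n = x#0y#0→xy#0 (nat[1+n]#0 8) (^-#0 x#0 n)

  H⁽³⁾ : (a b c r s t : Carrier) → ℕ → Carrier
  H⁽³⁾ a b c r s t 0 = a
  H⁽³⁾ a b c r s t 1 = b
  H⁽³⁾ a b c r s t 2 = c
  H⁽³⁾ a b c r s t (suc (suc (suc n))) =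
      r * H⁽³⁾ a b c r s t (suc (suc n))
    + s * H⁽³⁾ a b c r s t (suc n)
    + t * H⁽³⁾ a b c r s t n

  T⁽³⁾ : ℕ → Carrier
  T⁽³⁾ 0 = 0#
  T⁽³⁾ 1 = 0#
  T⁽³⁾ 2 = 1#
  T⁽³⁾ (suc (suc (suc n))) =
    T⁽³⁾ (suc (suc n)) + nat 3 * T⁽³⁾ (suc n) + nat 9 * T⁽³⁾ n

-- Both sides of H⁽³⁾ₙ₊₁ = 9 λⁿ⁺¹ T⁽³⁾ₙ satisfy the same third-order recurrence,
-- and they agree at n = 0, 1, 2; this holds for every λ. For λ apart from 0, the
-- factor 9 λⁿ⁺¹ can then be inverted.

module Submission where

open import Defs
open import Data.Nat.Base using (ℕ; suc; 2+; _∸_; _≤_; s≤s)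
open import Algebra.Bundles using (CommutativeRing)
open import Data.Product.Base using (proj₁; proj₂)
import Algebra.Apartness.Properties.HeytingCommutativeRing as HCRProperties
import Algebra.Solver.Ring.NaturalCoefficients.Default as SemiringSolver
import Relation.Binary.Reasoning.Setoid as SetoidReasoning

module _ {c ℓ₁ ℓ₂} (ℝ : RealNumbers c ℓ₁ ℓ₂) where

  open RealNumbers ℝ
  open Horadam ℝ
  open CommutativeRing commutativeRing using (commutativeSemiring)
  open HCRProperties heytingCommutativeRing using (x-0≈x)
  open SemiringSolver commutativeSemiring using (solve; con; _:+_; _:*_; _:^_; _:=_)
  open SetoidReasoning setoid

  -- `#⇒invertible` yields an inverse of `x - 0#`, so the factor `x` is first replaced by `x - 0#`.
  1/-inverseˡ : ∀ {x} (x#0 : x # 0#) → 1/ x ⟨ x#0 ⟩ * x ≈ 1#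
  1/-inverseˡ {x} x#0 = begin
    1/ x ⟨ x#0 ⟩ * x         ≈⟨ *-congˡ (x-0≈x x) ⟨
    1/ x ⟨ x#0 ⟩ * (x - 0#)  ≈⟨ proj₁ (proj₂ (#⇒invertible x#0)) ⟩
    1#                       ∎

  module _ (x : Carrier) where

    private
      H : ℕ → Carrier
      H = H⁽³⁾ 1# 0# 0# x (nat 3 * x ^ 2) (nat 9 * x ^ 3)

    -- Being free of division, this reduces to commutative semiring identities. The induction
    -- reaches back three indices, hence three base cases.
    H[1+n]≈9x¹⁺ⁿT[n] : ∀ n → H (suc n) ≈ nat 9 * x ^ suc n * T⁽³⁾ n
    H[1+n]≈9x¹⁺ⁿT[n] 0 = sym (zeroʳ _)
    H[1+n]≈9x¹⁺ⁿT[n] 1 = sym (zeroʳ _)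
    -- The recurrence for `H 3` leaves only the seed `H 0 = 1#`, with coefficient `nat 9 * x ^ 3`;
    -- on the right `T⁽³⁾ 2 = 1#`.
    H[1+n]≈9x¹⁺ⁿT[n] 2 = solve 3
      (λ x a b → x :* con 0 :+ a :* x :^ 2 :* con 0 :+ b :* x :^ 3 :* con 1
              := b :* x :^ 3 :* con 1)
      refl x (nat 3) (nat 9)
    H[1+n]≈9x¹⁺ⁿT[n] (suc (suc (suc n))) = begin
      x * H (suc (2+ n)) + nat 3 * x ^ 2 * H (2+ n) + nat 9 * x ^ 3 * H (suc n)
        ≈⟨ +-cong (+-cong (*-congˡ (H[1+n]≈9x¹⁺ⁿT[n] (2+ n)))
                          (*-congˡ (H[1+n]≈9x¹⁺ⁿT[n] (suc n))))
                  (*-congˡ (H[1+n]≈9x¹⁺ⁿT[n] n)) ⟩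
      x * (nat 9 * x ^ (suc (2+ n)) * T⁽³⁾ (2+ n))
        + nat 3 * x ^ 2 * (nat 9 * x ^ (2+ n) * T⁽³⁾ (suc n))
        + nat 9 * x ^ 3 * (nat 9 * x ^ suc n * T⁽³⁾ n)
        -- With `p` for `x ^ n`, each summand contains `b` times the same power, n + 4, of `x`: the
        -- weights 1, 2, 3 of the coefficients make up for the falling exponents. Factoring it out
        -- leaves the recurrence of `T⁽³⁾`.
        ≈⟨ solve 7
             (λ x p a b t₂ t₁ t₀ →
                  x :* (b :* (x :* (x :* (x :* p))) :* t₂)
                    :+ a :* x :^ 2 :* (b :* (x :* (x :* p)) :* t₁)
                    :+ b :* x :^ 3 :* (b :* (x :* p) :* t₀)
               := b :* (x :* (x :* (x :* (x :* p)))) :* (t₂ :+ a :* t₁ :+ b :* t₀))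
             refl x (x ^ n) (nat 3) (nat 9) (T⁽³⁾ (2+ n)) (T⁽³⁾ (suc n)) (T⁽³⁾ n) ⟩
      nat 9 * x ^ suc (suc (2+ n)) * T⁽³⁾ (suc (2+ n)) ∎

proposition3p2 : ∀ {c ℓ₁ ℓ₂} (ℝ : RealNumbers c ℓ₁ ℓ₂) →
    let open RealNumbers ℝ
        open Horadam ℝ
    in (lam : Carrier) (lam#0 : lam # 0#) (n : ℕ) → 2 ≤ n →
       T⁽³⁾ (n ∸ 1)
         ≈ 1/ nat 9 * lam ^ n ⟨ 9xⁿ#0 lam#0 n ⟩
           * H⁽³⁾ 1# 0# 0# lam (nat 3 * lam ^ 2) (nat 9 * lam ^ 3) n
-- With the index in the form `suc n`, `suc n ∸ 1` reduces to `n`, which matches the index shift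
-- between `H⁽³⁾` and `T⁽³⁾`.
proposition3p2 ℝ lam lam#0 (suc n) (s≤s _) = begin
  T⁽³⁾ n                       ≈⟨ *-identityˡ (T⁽³⁾ n) ⟨
  1# * T⁽³⁾ n                  ≈⟨ *-congʳ (1/-inverseˡ ℝ d#0) ⟨
  1/ d ⟨ d#0 ⟩ * d * T⁽³⁾ n    ≈⟨ *-assoc (1/ d ⟨ d#0 ⟩) d (T⁽³⁾ n) ⟩
  1/ d ⟨ d#0 ⟩ * (d * T⁽³⁾ n)  ≈⟨ *-congˡ (H[1+n]≈9x¹⁺ⁿT[n] ℝ lam n) ⟨
  1/ d ⟨ d#0 ⟩ * H⁽³⁾ 1# 0# 0# lam (nat 3 * lam ^ 2) (nat 9 * lam ^ 3) (suc n) ∎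
  where
  open RealNumbers ℝ
  open Horadam ℝ
  open SetoidReasoning setoid

  d : Carrier
  d = nat 9 * lam ^ suc n

  d#0 : d # 0#
  d#0 = 9xⁿ#0 lam#0 (suc n)
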